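{- The total domination number of the fractal cubic network $FCN(1)$ is $\gamma_t(FCN(1)) = 8$.
   Context: Fractal cubic network: for an integer $l\ge 0$, $FCN(l)$ is the finite simple graph whose vertices are all binary strings of length $2l+2$, defined recursively as follows. $FCN(0)$ is the 4-cycle with vertices $00, 01, 11, 10$ in this cyclic order. For $l\ge 1$, $FCN(l)$ is obtained from the disjoint union of the four copies $ab\,\Vert\,FCN(l-1)$, $a,b\in\{0,1\}$ (each vertex string of $FCN(l-1)$ is prefixed by $ab$, adjacency inside a copy being that of $FCN(l-1)$), by adding the four edges $\{00w,10w\}$, $\{10w,11w\}$, $\{11w,01w\}$, $\{01w,00w\}$, where $w=10(01)^{l-1}$ is the string $10$ followed by $l-1$ repetitions of $01$. A total dominating set of a graph $\Gamma$ is a set $D\subseteq V(\Gamma)$ such that every vertex of $\Gamma$ (including those in $D$) is adjacent to some vertex of $D$; $\gamma_t(\Gamma)$ is the minimum size of a total dominating set. -}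

module Defs where

open import Data.Fin.Base using (Fin)
open import Data.Fin.Patterns using (0F; 1F)
open import Data.List.Base using (List; length)
open import Data.List.Membership.Propositional using (_∈_)
open import Data.List.Relation.Unary.Unique.Propositional using (Unique)
open import Data.Nat.Base using (ℕ; suc; _+_; _*_; _≤_)
open import Data.Product.Base using (_×_; ∃-syntax)
open import Data.Vec.Base using (Vec; []; _∷_; concat; replicate)
open import Data.Vec.Properties using (∷-injectiveʳ)
open import Level using (0ℓ)
open import Relation.Binary.Construct.Closure.Symmetric as Sym using (SymClosure; fwd; bwd)
open import Relation.Binary.Core using (Rel)
open import Relation.Binary.Definitions using (Symmetric)
open import Relation.Binary.PropositionalEquality using (_≡_; _≢_; refl)
open import Relation.Nullary.Negation using (¬_)

record SimpleGraph : Set₁ where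
  field
    Vertex     : Set
    Adj        : Rel Vertex 0ℓ
    adj-sym    : Symmetric Adj
    adj-irrefl : ∀ {v} → ¬ Adj v v

module _ (Γ : SimpleGraph) where
  open SimpleGraph Γ

  -- Finite vertex sets are duplicate-free lists, so that `length` is the
  -- cardinality.
  record IsTotalDominatingSet (D : List Vertex) : Set where
    field
      unique    : Unique D
      dominates : ∀ v → ∃[ u ] (u ∈ D × Adj v u)

  -- γₜ(Γ) = n: the minimum size of a total dominating set exists and is n.
  record HasTotalDominationNumber (n : ℕ) : Set where
    field
      attained : ∃[ D ] (IsTotalDominatingSet D × length D ≡ n)
      minimal  : ∀ D → IsTotalDominatingSet D → n ≤ length D

-- Binary strings of length 2l + 2.  The length is written so that it reduces
-- to two successors, which makes prefixing by two bits well typed at suc l.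
BitString : ℕ → Set
BitString l = Vec (Fin 2) (2 + l * 2)

-- The string 10(01)ˡ, at which the four copies of FCN(l) are joined to form
-- FCN(l + 1).
junction : ∀ l → BitString l
junction l = 1F ∷ 0F ∷ concat (replicate l (0F ∷ 1F ∷ []))

-- Each undirected edge is listed in one orientation only.
data Edge : ∀ l → Rel (BitString l) 0ℓ where
  cycle₁ : Edge 0 (0F ∷ 0F ∷ []) (0F ∷ 1F ∷ [])
  cycle₂ : Edge 0 (0F ∷ 1F ∷ []) (1F ∷ 1F ∷ [])
  cycle₃ : Edge 0 (1F ∷ 1F ∷ []) (1F ∷ 0F ∷ [])
  cycle₄ : Edge 0 (1F ∷ 0F ∷ []) (0F ∷ 0F ∷ [])
  copy   : ∀ {l u v} a b → Edge l u v → Edge (suc l) (a ∷ b ∷ u) (a ∷ b ∷ v)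
  join₁  : ∀ {l} → Edge (suc l) (0F ∷ 0F ∷ junction l) (1F ∷ 0F ∷ junction l)
  join₂  : ∀ {l} → Edge (suc l) (1F ∷ 0F ∷ junction l) (1F ∷ 1F ∷ junction l)
  join₃  : ∀ {l} → Edge (suc l) (1F ∷ 1F ∷ junction l) (0F ∷ 1F ∷ junction l)
  join₄  : ∀ {l} → Edge (suc l) (0F ∷ 1F ∷ junction l) (0F ∷ 0F ∷ junction l)

Edge⇒≢ : ∀ {l u v} → Edge l u v → u ≢ v
Edge⇒≢ cycle₁       ()
Edge⇒≢ cycle₂       ()
Edge⇒≢ cycle₃       ()
Edge⇒≢ cycle₄       ()
Edge⇒≢ (copy a b e) eq = Edge⇒≢ e (∷-injectiveʳ (∷-injectiveʳ eq))
Edge⇒≢ join₁        ()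
Edge⇒≢ join₂        ()
Edge⇒≢ join₃        ()
Edge⇒≢ join₄        ()

FCN : ℕ → SimpleGraph
FCN l = record
  { Vertex     = BitString l
  ; Adj        = SymClosure (Edge l)
  ; adj-sym    = Sym.symmetric (Edge l)
  ; adj-irrefl = λ { (fwd e) → Edge⇒≢ e refl ; (bwd e) → Edge⇒≢ e refl }
  }

{-# OPTIONS --safe #-}

-- In each of the four copies of the 4-cycle, the vertices ab00 and ab01 have
-- no neighbours outside the copy, and their neighbourhoods {ab01, ab10} and
-- {ab00, ab11} are disjoint.  These eight pairwise disjoint neighbourhoods
-- must all meet a total dominating set; taking an adjacent pair in each copy
-- shows that eight vertices suffice.
module Submission where

open import Defs
open import Data.Fin.Base using (Fin; zero; suc)
open import Data.Fin.Patterns using (0F; 1F)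
open import Data.Fin.Properties using (injective⇒≤; _≟_)
open import Data.List.Base using (List; []; _∷_; _++_; length; lookup)
open import Data.List.Membership.Propositional using (_∈_)
open import Data.List.Membership.Propositional.Properties using (∈-++⁺ˡ; ∈-++⁺ʳ; ∈-lookup)
open import Data.List.Membership.Setoid.Properties using (index-injective)
open import Data.List.Relation.Unary.All as All using (All; []; _∷_)
open import Data.List.Relation.Unary.All.Properties using (++⁺)
open import Data.List.Relation.Unary.Any using (here; there; index)
open import Data.List.Relation.Unary.AllPairs using (_∷_)
open import Data.List.Relation.Unary.Unique.Propositional using (Unique)
open import Data.Nat.Base using (_+_; _≤_)
open import Data.Product.Base using (_,_; proj₁; proj₂)
open import Data.Vec.Base using (Vec; []; _∷_)
open import Data.Vec.Properties using (≡-dec)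
open import Function.Definitions using (Injective)
open import Relation.Binary.Construct.Closure.Symmetric using (fwd; bwd)
open import Relation.Binary.PropositionalEquality using (_≡_; refl; sym; cong; setoid; module ≡-Reasoning)
open import Relation.Nullary.Decidable using (from-yes)
open import Relation.Nullary.Negation using (contradiction)

open import Data.List.Relation.Unary.Unique.DecPropositional (≡-dec {n = 4} (_≟_ {2})) using (unique?)

lookup-injective : ∀ {A : Set} {xs : List A} → Unique xs → Injective _≡_ _≡_ (lookup xs)
lookup-injective (x∉ ∷ xs!) {zero}  {zero}  eq = refl
lookup-injective (x∉ ∷ xs!) {zero}  {suc j} eq = contradiction eq (All.lookup x∉ (∈-lookup j))
lookup-injective (x∉ ∷ xs!) {suc i} {zero}  eq = contradiction (sym eq) (All.lookup x∉ (∈-lookup i))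
lookup-injective (x∉ ∷ xs!) {suc i} {suc j} eq = cong suc (lookup-injective xs! eq)

module _ (Γ : SimpleGraph) where
  open SimpleGraph Γ

  -- The map `owner` witnesses that the neighbourhoods of the vertices in ws
  -- are pairwise disjoint.
  openPacking⇒length≤ : ∀ {D ws} (owner : Vertex → Vertex) →
                        Unique ws →
                        All (λ w → ∀ {u} → Adj w u → owner u ≡ w) ws →
                        IsTotalDominatingSet Γ D →
                        length ws ≤ length D
  -- Choose for each entry of `ws` a dominator in `D` and record its position there. The position
  -- fixes the dominator, and `owner` recovers the entry from the dominator, so no two entries share
  -- a position.
  openPacking⇒length≤ {D} {ws} owner ws! owned tds = injective⇒≤ position-injective
    where
    open IsTotalDominatingSet tds
    open ≡-Reasoning

    dominator : Fin (length ws) → Vertex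
    dominator i = proj₁ (dominates (lookup ws i))

    dominator∈D : ∀ i → dominator i ∈ D
    dominator∈D i = proj₁ (proj₂ (dominates (lookup ws i)))

    owner-dominator : ∀ i → owner (dominator i) ≡ lookup ws i
    owner-dominator i =
      All.lookup owned (∈-lookup i) (proj₂ (proj₂ (dominates (lookup ws i))))

    position : Fin (length ws) → Fin (length D)
    position i = index (dominator∈D i)

    position-injective : Injective _≡_ _≡_ position
    position-injective {i} {j} eq = lookup-injective ws! (begin
      lookup ws i         ≡⟨ owner-dominator i ⟨
      owner (dominator i) ≡⟨ cong owner (index-injective (setoid Vertex) (dominator∈D i) (dominator∈D j) eq) ⟩
      owner (dominator j) ≡⟨ owner-dominator j ⟩
      lookup ws j         ∎)

-- Both eight-vertex sets below choose the same two vertices of the 4-cycle in every copy, so each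
-- is a union of two such lists.
inAllCopies : ∀ {n} → Vec (Fin 2) n → List (Vec (Fin 2) (2 + n))
inAllCopies u =
  (0F ∷ 0F ∷ u) ∷ (0F ∷ 1F ∷ u) ∷ (1F ∷ 0F ∷ u) ∷ (1F ∷ 1F ∷ u) ∷ []

∈-inAllCopies : ∀ {n} a b (u : Vec (Fin 2) n) → a ∷ b ∷ u ∈ inAllCopies u
∈-inAllCopies 0F 0F u = here refl
∈-inAllCopies 0F 1F u = there (here refl)
∈-inAllCopies 1F 0F u = there (there (here refl))
∈-inAllCopies 1F 1F u = there (there (there (here refl)))

All-inAllCopies : ∀ {n} {P : Vec (Fin 2) (2 + n) → Set} {u : Vec (Fin 2) n} →
                  (∀ a b → P (a ∷ b ∷ u)) → All P (inAllCopies u)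
All-inAllCopies p = p 0F 0F ∷ p 0F 1F ∷ p 1F 0F ∷ p 1F 1F ∷ []

00₀ 01₀ 10₀ : BitString 0
00₀ = 0F ∷ 0F ∷ []
01₀ = 0F ∷ 1F ∷ []
10₀ = 1F ∷ 0F ∷ []

-- The ends `10` and `00` of an edge of the 4-cycle have neighbourhoods `00`, `11` and `01`, `10`,
-- which together cover the whole cycle.
dominatingSet : List (BitString 1)
dominatingSet = inAllCopies 10₀ ++ inAllCopies 00₀

dominatingSet-isTotalDominating : IsTotalDominatingSet (FCN 1) dominatingSet
dominatingSet-isTotalDominating = record
  { unique    = from-yes (unique? dominatingSet)
  ; dominates = λ
      { (a ∷ b ∷ 0F ∷ 0F ∷ []) → _ , 10∈ a b , bwd (copy a b cycle₄)
      ; (a ∷ b ∷ 0F ∷ 1F ∷ []) → _ , 00∈ a b , bwd (copy a b cycle₁)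
      ; (a ∷ b ∷ 1F ∷ 0F ∷ []) → _ , 00∈ a b , fwd (copy a b cycle₄)
      ; (a ∷ b ∷ 1F ∷ 1F ∷ []) → _ , 10∈ a b , fwd (copy a b cycle₃)
      }
  }
  where
  10∈ : ∀ a b → a ∷ b ∷ 10₀ ∈ dominatingSet
  10∈ a b = ∈-++⁺ˡ (∈-inAllCopies a b 10₀)

  00∈ : ∀ a b → a ∷ b ∷ 00₀ ∈ dominatingSet
  00∈ a b = ∈-++⁺ʳ (inAllCopies 10₀) (∈-inAllCopies a b 00₀)

packing : List (BitString 1)
packing = inAllCopies 00₀ ++ inAllCopies 01₀

-- In a 4-cycle every vertex is adjacent to exactly one end of a given edge; here the edge joins
-- `00` and `01`, and the owner is that end.
packingOwner : BitString 1 → BitString 1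
packingOwner (a ∷ b ∷ 0F ∷ 0F ∷ []) = a ∷ b ∷ 01₀
packingOwner (a ∷ b ∷ 0F ∷ 1F ∷ []) = a ∷ b ∷ 00₀
packingOwner (a ∷ b ∷ 1F ∷ 0F ∷ []) = a ∷ b ∷ 00₀
packingOwner (a ∷ b ∷ 1F ∷ 1F ∷ []) = a ∷ b ∷ 01₀

open SimpleGraph (FCN 1) using (Adj)

-- Since `junction 0` is `10`, every join edge has both ends of the form `ab10`. Unification
-- therefore excludes the joins at `ab00`, leaving the two cycle edges of the copy.
owner-00 : ∀ a b {u} → Adj (a ∷ b ∷ 00₀) u → packingOwner u ≡ a ∷ b ∷ 00₀
owner-00 a b (fwd (copy a b cycle₁)) = refl
owner-00 a b (bwd (copy a b cycle₄)) = refl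

owner-01 : ∀ a b {u} → Adj (a ∷ b ∷ 01₀) u → packingOwner u ≡ a ∷ b ∷ 01₀
owner-01 a b (fwd (copy a b cycle₂)) = refl
owner-01 a b (bwd (copy a b cycle₁)) = refl

theorem21 : HasTotalDominationNumber (FCN 1) 8
theorem21 = record
  { attained = dominatingSet , dominatingSet-isTotalDominating , refl
  -- The bound is stated with `length packing`, which evaluates to 8.
  ; minimal  = λ D → openPacking⇒length≤ (FCN 1) packingOwner
      (from-yes (unique? packing))
      (++⁺ (All-inAllCopies owner-00) (All-inAllCopies owner-01))
  }
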